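{- Let $k\geq 2$ and $n\geq k+1$ be integers. Then in $\mathcal{H}$, $$ \sum_{\substack{r, s_i\geq 1,\ s_1\geq 2\\ r+s_1+\cdots +s_{k-1}=n}} z_{r}\,\tilde{\sqcup}\, z_{s_1,\dots, s_{k-1}} = \sum_{\substack{t_i\geq 1\\ t_1+\cdots+t_{k}=n }} \big[ C(t_1,\dots, t_{k-1})- C(t_2,\dots, t_{k-1})\big] z_{t_1,\dots, t_{k}} - \sum_{ \substack{ t_i\geq 1,\ t_2=1 \\ t_1+\cdots+t_{k}=n }} z_{t_1,\dots, t_{k}}, $$ with the convention $C(t_2,\dots,t_{k-1})=C(\emptyset)=1$ when $k=2$.
   Context: Let $\mathcal{H}$ be the free $\mathbb{Z}$-module on words in letters $z_s$ ($s\geq1$), with $z_{s_1,\dots,s_k}:=z_{s_1}\cdots z_{s_k}$ and $1$ the empty word. Let $\mathbb{Z}\langle x_0,x_1\rangle$ be the free $\mathbb{Z}$-module on words in two letters $x_0,x_1$, with the shuffle product $\sqcup$ defined bilinearly and recursively by $1\sqcup u=u\sqcup 1=u$ and $(au)\sqcup(bv)=a(u\sqcup (bv))+b((au)\sqcup v)$ for letters $a,b\in\{x_0,x_1\}$ and words $u,v$. Let $\rho$ be the $\mathbb{Z}$-linear bijection from $\mathbb{Z}\oplus \mathbb{Z}\langle x_0,x_1\rangle x_1$ (span of $1$ and words ending in $x_1$) onto $\mathcal{H}$ given by $\rho(1)=1$ and $\rho(x_0^{s_1-1}x_1\cdots x_0^{s_k-1}x_1)=z_{s_1,\dots,s_k}$.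 Define the product $\tilde{\sqcup}$ on $\mathcal{H}$ by $w_1\,\tilde{\sqcup}\,w_2=\rho\big(\rho^{ -1}(w_1)\sqcup\rho^{ -1}(w_2)\big)$. For $m\geq 1$ and positive integers $t_1,\dots,t_{m}$ with $T_j=t_1+\cdots+t_j$, set $C(t_1,\dots,t_{m})=\sum_{j=1}^{m}2^{T_j-j}+2^{T_{m}-m}$; also $C(\emptyset)=1$. In particular $C(t_2,\dots,t_{k-1})$ denotes this quantity applied to the tuple $(t_2,\dots,t_{k-1})$. -}

module Defs where

open import Data.Bool.Base using (if_then_else_)
open import Data.Integer.Base as ℤ using (ℤ; 0ℤ; 1ℤ)
open import Data.List.Base as List using (List; []; _∷_; _++_; concatMap; replicate; upTo)
import Data.List.Properties as List
open import Data.List.Membership.Propositional using (_∈_; find; lose)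
open import Data.List.Membership.Propositional.Properties using (∈-map⁺; ∈-map⁻; ∈-concatMap⁺; ∈-concatMap⁻; ∈-upTo⁺; ∈-upTo⁻)
open import Data.List.Relation.Unary.All as All using (All; []; _∷_)
import Data.List.Relation.Unary.All.Properties as All
open import Data.List.Relation.Unary.AllPairs as AllPairs using ([]; _∷_)
import Data.List.Relation.Unary.AllPairs.Properties as AllPairs
open import Data.List.Relation.Unary.Any using (here)
open import Data.List.Relation.Unary.Unique.Propositional using (Unique)
import Data.List.Relation.Unary.Unique.Propositional.Properties as Unique
open import Data.Nat.Base as ℕ using (ℕ; zero; suc; _+_; _∸_; _^_; NonZero)
open import Data.Nat.ListAction using (sum)
import Data.Nat.Properties as ℕ
open import Data.Product.Base using (_×_; _,_; proj₂)
open import Data.Vec.Base as Vec using (Vec; []; _∷_; toList)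
import Data.Vec.Properties as Vec
open import Data.Unit.Base using (⊤; tt)
open import Function.Base using (_∘_)
open import Relation.Binary.Definitions using (DecidableEquality)
open import Relation.Binary.PropositionalEquality using (_≡_; _≢_; refl; sym; trans; cong; cong₂; subst)
open import Relation.Nullary.Decidable using (does; map′)

private
  variable
    A B C′ : Set

-- Formal ℤ-linear combinations of elements of B. A basis element may be
-- listed several times or with coefficient 0; the free module is Lin B up
-- to equality of all coefficients (see _≈_ below).

Lin : Set → Set
Lin B = List (ℤ × B)

basis : B → Lin B
basis b = (1ℤ , b) ∷ []

infixl 6 _⊕_ _⊖_
infixr 7 _·_

_⊕_ : Lin B → Lin B → Lin B
_⊕_ = _++_

_·_ : ℤ → Lin B → Lin B
c · p = List.map (λ (d , b) → c ℤ.* d , b) p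

_⊖_ : Lin B → Lin B → Lin B
p ⊖ q = p ⊕ (ℤ.- 1ℤ) · q

∑ : List A → (A → Lin B) → Lin B
∑ xs f = List.foldr (λ x p → f x ⊕ p) [] xs

linear : (A → Lin B) → Lin A → Lin B
linear f p = ∑ p (λ (c , a) → c · f a)

bilinear : (A → B → Lin C′) → Lin A → Lin B → Lin C′
bilinear f p q = linear (λ a → linear (f a) q) p

coeff : DecidableEquality B → Lin B → B → ℤ
coeff _≟_ []            b = 0ℤ
coeff _≟_ ((c , a) ∷ p) b = (if does (a ≟ b) then c else 0ℤ) ℤ.+ coeff _≟_ p b

record ℕ⁺ : Set where
  constructor pos
  field
    value        : ℕ
    .{{nonZero}} : NonZero value

open ℕ⁺ public using (value)

value-injective : ∀ {s t} → value s ≡ value t → s ≡ t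
value-injective refl = refl

infix 4 _≟⁺_ _≈_

_≟⁺_ : DecidableEquality ℕ⁺
s ≟⁺ t = map′ value-injective (cong value) (value s ℕ.≟ value t)

-- The list s₁ ∷ … ∷ s_k ∷ [] is the word z_{s₁} ⋯ z_{s_k}.

ZWord : Set
ZWord = List ℕ⁺

𝓗 : Set
𝓗 = Lin ZWord

_≈_ : 𝓗 → 𝓗 → Set
p ≈ q = ∀ w → coeff (List.≡-dec _≟⁺_) p w ≡ coeff (List.≡-dec _≟⁺_) q w

z : ∀ {k} → Vec ℕ⁺ k → 𝓗
z s = basis (toList s)

data X : Set where
  x₀ x₁ : X

XWord : Set
XWord = List X

ℤ⟨x₀,x₁⟩ : Set
ℤ⟨x₀,x₁⟩ = Lin XWord

prepend : X → ℤ⟨x₀,x₁⟩ → ℤ⟨x₀,x₁⟩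
prepend a = linear (λ w → basis (a ∷ w))

infixl 7 _⧢ʷ_ _⧢_ _⧢̃_

_⧢ʷ_ : XWord → XWord → ℤ⟨x₀,x₁⟩
[]      ⧢ʷ v       = basis v
(a ∷ u) ⧢ʷ []      = basis (a ∷ u)
(a ∷ u) ⧢ʷ (b ∷ v) = prepend a (u ⧢ʷ (b ∷ v)) ⊕ prepend b ((a ∷ u) ⧢ʷ v)

_⧢_ : ℤ⟨x₀,x₁⟩ → ℤ⟨x₀,x₁⟩ → ℤ⟨x₀,x₁⟩
_⧢_ = bilinear _⧢ʷ_

data EndsInX₁ : XWord → Set where
  [x₁] : EndsInX₁ (x₁ ∷ [])
  _∷_  : ∀ a {u} → EndsInX₁ u → EndsInX₁ (a ∷ u)

data Admissible : XWord → Set where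
  empty : Admissible []
  ends  : ∀ {w} → EndsInX₁ w → Admissible w

-- InSpan Admissible is membership in ℤ ⊕ ℤ⟨x₀,x₁⟩x₁, the domain of ρ.

InSpan : (B → Set) → Lin B → Set
InSpan P = All (P ∘ proj₂)

basis-span : ∀ {P : B → Set} {b} → P b → InSpan P (basis b)
basis-span h = h ∷ []

·-span : ∀ {P : B → Set} c {p} → InSpan P p → InSpan P (c · p)
·-span c []       = []
·-span c (h ∷ hs) = h ∷ ·-span c hs

linear-span : ∀ {P : A → Set} {Q : B → Set} {f : A → Lin B} →
              (∀ {a} → P a → InSpan Q (f a)) →
              ∀ {p} → InSpan P p → InSpan Q (linear f p)
linear-span hf             []       = []
linear-span hf {(c , _) ∷ _} (h ∷ hs) = All.++⁺ (·-span c (hf h)) (linear-span hf hs)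

prepend-ends : ∀ a {p} → InSpan EndsInX₁ p → InSpan EndsInX₁ (prepend a p)
prepend-ends a = linear-span (λ h → basis-span (a ∷ h))

⧢ʷ-identityʳ : ∀ u → u ⧢ʷ [] ≡ basis u
⧢ʷ-identityʳ []      = refl
⧢ʷ-identityʳ (_ ∷ _) = refl

⧢ʷ-ends : ∀ {u v} → EndsInX₁ u → EndsInX₁ v → InSpan EndsInX₁ (u ⧢ʷ v)
⧢ʷ-ends hu@([x₁])  hv@([x₁])  = All.++⁺ (prepend-ends x₁ (basis-span hv)) (prepend-ends x₁ (basis-span hu))
⧢ʷ-ends hu@([x₁])  hv@(b ∷ h) = All.++⁺ (prepend-ends x₁ (basis-span hv)) (prepend-ends b (⧢ʷ-ends hu h))
⧢ʷ-ends hu@(a ∷ h) hv@([x₁])  = All.++⁺ (prepend-ends a (⧢ʷ-ends h hv)) (prepend-ends x₁ (basis-span hu))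
⧢ʷ-ends hu@(a ∷ h) hv@(b ∷ h′) = All.++⁺ (prepend-ends a (⧢ʷ-ends h hv)) (prepend-ends b (⧢ʷ-ends hu h′))

⧢ʷ-admissible : ∀ {u v} → Admissible u → Admissible v → InSpan Admissible (u ⧢ʷ v)
⧢ʷ-admissible         empty     hv        = basis-span hv
⧢ʷ-admissible {u = u} (ends hu) empty     = subst (InSpan Admissible) (sym (⧢ʷ-identityʳ u)) (basis-span (ends hu))
⧢ʷ-admissible         (ends hu) (ends hv) = All.map ends (⧢ʷ-ends hu hv)

⧢-admissible : ∀ {p q} → InSpan Admissible p → InSpan Admissible q → InSpan Admissible (p ⧢ q)
⧢-admissible hp hq = linear-span (λ hu → linear-span (⧢ʷ-admissible hu) hq) hp

-- i is the number of letters x₀ read since the last x₁.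

ρᵉ : ℕ → ∀ {w} → EndsInX₁ w → ZWord
ρᵉ i [x₁]     = pos (suc i) ∷ []
ρᵉ i (x₀ ∷ h) = ρᵉ (suc i) h
ρᵉ i (x₁ ∷ h) = pos (suc i) ∷ ρᵉ 0 h

ρʷ : ∀ {w} → Admissible w → ZWord
ρʷ empty    = []
ρʷ (ends h) = ρᵉ 0 h

ρ : ∀ {p} → InSpan Admissible p → 𝓗
ρ {p = []}          []       = []
ρ {p = (c , _) ∷ _} (h ∷ hs) = c · basis (ρʷ h) ⊕ ρ hs

ρ⁻¹ʷ : ZWord → XWord
ρ⁻¹ʷ []       = []
ρ⁻¹ʷ (s ∷ ss) = replicate (value s ∸ 1) x₀ ++ x₁ ∷ ρ⁻¹ʷ ss

ρ⁻¹ : 𝓗 → ℤ⟨x₀,x₁⟩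
ρ⁻¹ = linear (λ s → basis (ρ⁻¹ʷ s))

x₀^_∷_ : ∀ i {w} → EndsInX₁ w → EndsInX₁ (replicate i x₀ ++ w)
x₀^ zero  ∷ h = h
x₀^ suc i ∷ h = x₀ ∷ (x₀^ i ∷ h)

ρ⁻¹ʷ-ends : ∀ s ss → EndsInX₁ (ρ⁻¹ʷ (s ∷ ss))
ρ⁻¹ʷ-ends s []        = x₀^ (value s ∸ 1) ∷ [x₁]
ρ⁻¹ʷ-ends s (s′ ∷ ss) = x₀^ (value s ∸ 1) ∷ (x₁ ∷ ρ⁻¹ʷ-ends s′ ss)

ρ⁻¹ʷ-admissible : ∀ w → Admissible (ρ⁻¹ʷ w)
ρ⁻¹ʷ-admissible []       = empty
ρ⁻¹ʷ-admissible (s ∷ ss) = ends (ρ⁻¹ʷ-ends s ss)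

ρ⁻¹-admissible : ∀ p → InSpan Admissible (ρ⁻¹ p)
ρ⁻¹-admissible p = linear-span {P = λ _ → ⊤} (λ {w} _ → basis-span (ρ⁻¹ʷ-admissible w)) (All.universal (λ _ → tt) p)

_⧢̃_ : 𝓗 → 𝓗 → 𝓗
p ⧢̃ q = ρ (⧢-admissible (ρ⁻¹-admissible p) (ρ⁻¹-admissible q))

ρᵉ-x₀^ : ∀ j i {w} (h : EndsInX₁ w) → ρᵉ j (x₀^ i ∷ h) ≡ ρᵉ (i + j) h
ρᵉ-x₀^ j zero    h = refl
ρᵉ-x₀^ j (suc i) h = trans (ρᵉ-x₀^ (suc j) i h) (cong (λ l → ρᵉ l h) (ℕ.+-suc i j))

pos-suc : ∀ (s : ℕ⁺) → pos (suc (value s ∸ 1 + 0)) ≡ s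
pos-suc (pos (suc i)) = value-injective (cong suc (ℕ.+-identityʳ i))

ρᵉ-ρ⁻¹ʷ : ∀ s ss → ρᵉ 0 (ρ⁻¹ʷ-ends s ss) ≡ s ∷ ss
ρᵉ-ρ⁻¹ʷ s []        = trans (ρᵉ-x₀^ 0 (value s ∸ 1) [x₁]) (cong (_∷ []) (pos-suc s))
ρᵉ-ρ⁻¹ʷ s (s′ ∷ ss) = trans (ρᵉ-x₀^ 0 (value s ∸ 1) (x₁ ∷ ρ⁻¹ʷ-ends s′ ss))
                            (cong₂ _∷_ (pos-suc s) (ρᵉ-ρ⁻¹ʷ s′ ss))

ρʷ-ρ⁻¹ʷ : ∀ w → ρʷ (ρ⁻¹ʷ-admissible w) ≡ w
ρʷ-ρ⁻¹ʷ []       = refl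
ρʷ-ρ⁻¹ʷ (s ∷ ss) = ρᵉ-ρ⁻¹ʷ s ss

replicate-∷ : ∀ i (a : A) (u : List A) → replicate (suc i) a ++ u ≡ replicate i a ++ a ∷ u
replicate-∷ zero    a u = refl
replicate-∷ (suc i) a u = cong (a ∷_) (replicate-∷ i a u)

ρ⁻¹ʷ-ρᵉ : ∀ i {w} (h : EndsInX₁ w) → ρ⁻¹ʷ (ρᵉ i h) ≡ replicate i x₀ ++ w
ρ⁻¹ʷ-ρᵉ i [x₁]           = refl
ρ⁻¹ʷ-ρᵉ i (_∷_ x₀ {u} h) = trans (ρ⁻¹ʷ-ρᵉ (suc i) h) (replicate-∷ i x₀ u)
ρ⁻¹ʷ-ρᵉ i (x₁ ∷ h)       = cong (λ u → replicate i x₀ ++ x₁ ∷ u) (ρ⁻¹ʷ-ρᵉ 0 h)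

ρ⁻¹ʷ-ρʷ : ∀ {w} (h : Admissible w) → ρ⁻¹ʷ (ρʷ h) ≡ w
ρ⁻¹ʷ-ρʷ empty    = refl
ρ⁻¹ʷ-ρʷ (ends h) = ρ⁻¹ʷ-ρᵉ 0 h

-- T t j = t₁ + ⋯ + t_j

T : ∀ {m} → Vec ℕ⁺ m → ℕ → ℕ
T t j = sum (List.take j (List.map value (toList t)))

-- The truncated subtractions are exact, since T t j ≥ j for j ≤ m.

C : ∀ {m} → Vec ℕ⁺ m → ℕ
C {zero}  [] = 1
C {suc m} t  = sum (List.map (λ j → 2 ^ (T t j ∸ j)) (List.map suc (upTo (suc m))))
             + 2 ^ (T t (suc m) ∸ suc m)

weight : ∀ {k} → Vec ℕ⁺ k → ℕ
weight t = Vec.sum (Vec.map value t)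

-- compositions k n lists every (t₁,…,t_k) with tᵢ ≥ 1 and
-- t₁ + ⋯ + t_k = n exactly once, as proved below.

compositions : ∀ k → ℕ → List (Vec ℕ⁺ k)
compositions zero    zero    = [] ∷ []
compositions zero    (suc _) = []
compositions (suc k) n       = concatMap (λ i → List.map (pos (suc i) ∷_) (compositions k (n ∸ suc i))) (upTo n)

∈-compositions⁺ : ∀ {k} n (t : Vec ℕ⁺ k) → weight t ≡ n → t ∈ compositions k n
∈-compositions⁺ n []                refl = here refl
∈-compositions⁺ n (pos (suc i) ∷ t) refl =
  ∈-concatMap⁺ _ (lose (∈-upTo⁺ (ℕ.m≤m+n (suc i) (weight t)))
    (∈-map⁺ (pos (suc i) ∷_) (∈-compositions⁺ _ t (sym (ℕ.m+n∸m≡n (suc i) (weight t))))))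

∈-compositions⁻ : ∀ {k} n {t : Vec ℕ⁺ k} → t ∈ compositions k n → weight t ≡ n
∈-compositions⁻ {zero}  zero (here refl) = refl
∈-compositions⁻ {suc k} n    t∈
  with i , i∈ , t∈′ ← find (∈-concatMap⁻ (λ i → List.map (pos (suc i) ∷_) (compositions k (n ∸ suc i))) {xs = upTo n} t∈)
  with t , t∈″ , refl ← ∈-map⁻ (pos (suc i) ∷_) t∈′
  = trans (cong (suc i +_) (∈-compositions⁻ (n ∸ suc i) t∈″)) (ℕ.m+[n∸m]≡n (∈-upTo⁻ i∈))

compositions-unique : ∀ k n → Unique (compositions k n)
compositions-unique zero    zero    = [] ∷ []
compositions-unique zero    (suc n) = []
compositions-unique (suc k) n       = Unique.concat⁺
  (All.map⁺ (All.universal (λ i → Unique.map⁺ Vec.∷-injectiveʳ (compositions-unique k (n ∸ suc i))) (upTo n)))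
  (AllPairs.map⁺ (AllPairs.map disjoint (Unique.upTo⁺ n)))
  where
  disjoint : ∀ {i j} → i ≢ j → ∀ {t} → _
  disjoint {i} {j} i≢j {t} (t∈ , t∈′)
    with _ , _ , refl ← ∈-map⁻ (pos (suc i) ∷_) t∈
    with _ , _ , eq   ← ∈-map⁻ (pos (suc j) ∷_) t∈′
    = i≢j (ℕ.suc-injective (cong value (Vec.∷-injectiveˡ eq)))

{-# OPTIONS --safe #-}
module Submission where

-- The coefficient of a word in u ⧢ v is the number of ways of splitting its
-- letters into complementary subwords u and v. Summed over all z_r and
-- z_{s₁,…,s_{k-1}}, the coefficient of W = x₀^{t₁-1} x₁ ⋯ x₀^{t_k-1} x₁ is the
-- number of splittings in which u has the form x₀ ⋯ x₀ x₁ and v ends in x₁.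
-- Choosing the x₁ of u and the x₀'s of u before it gives C(t₁,…,t_{k-1}); the
-- last x₁ can only be chosen together with all x₀'s of the last block.
-- From these one removes the splittings with s₁ = 1, where v starts with x₁: if u
-- uses the first x₁ of W this forces t₂ = 1 and leaves one choice, and otherwise
-- the first block contributes nothing and the rest is counted by C(t₂,…,t_{k-1}).

open import Defs
open import Data.Integer.Base using (+_; _-_)
open import Data.List.Base using (filter)
open import Data.Nat.Base using (ℕ; _+_; _≤_)
open import Data.Nat.Properties using (_≤?_; _≟_)
open import Data.Vec.Base using ([_]; head; tail; init)

open import Data.Bool.Base using (true; false; if_then_else_)
open import Data.Integer.Base as ℤ using (ℤ; 0ℤ; 1ℤ)
import Data.Integer.Properties as ℤ
open import Data.Integer.Tactic.RingSolver using (solve-∀)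
open import Data.List.Base as List using (List; []; _∷_; _++_; length; replicate; upTo; applyUpTo)
import Data.List.Properties as List
open import Data.List.Membership.Propositional using (_∈_)
open import Data.List.Membership.Propositional.Properties using (∈-filter⁺; ∈-filter⁻)
open import Data.List.Relation.Ternary.Interleaving.Propositional using (Interleaving; []; consˡ; consʳ)
open import Data.List.Relation.Unary.All as All using ([]; _∷_)
open import Data.List.Relation.Unary.AllPairs using (_∷_)
open import Data.List.Relation.Unary.Any using (here; there)
open import Data.List.Relation.Unary.Unique.Propositional using (Unique)
import Data.List.Relation.Unary.Unique.Propositional.Properties as Unique
open import Data.Nat.Base as ℕ using (zero; suc; _*_; _∸_; _^_; _<_; z≤n; s≤s)
open import Data.Nat.ListAction using (sum)
import Data.Nat.Properties as ℕ
import Data.Nat.Tactic.RingSolver as ℕ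
open import Data.Product.Base using (∃; ∃₂; _×_; _,_; proj₁; proj₂)
open import Data.Sum.Base using (_⊎_; inj₁; inj₂)
open import Data.Vec.Base as Vec using (Vec; []; _∷_; toList; fromList)
import Data.Vec.Properties as Vec
open import Function.Base using (_∘_)
open import Relation.Binary.Definitions using (DecidableEquality)
open import Relation.Binary.PropositionalEquality using (_≡_; _≢_; refl; sym; trans; cong; cong₂; module ≡-Reasoning)
open import Relation.Nullary using (¬_; Dec; yes; no)
open import Relation.Nullary.Decidable using (does; dec-true; dec-false)

open ≡-Reasoning

private
  variable
    A B : Set
    m : ℕ

-- Indicators of decidable propositions

𝟙 : {P : Set} → Dec P → ℤ
𝟙 d = if does d then 1ℤ else 0ℤ

𝟙-true : {P : Set} (d : Dec P) → P → 𝟙 d ≡ 1ℤ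
𝟙-true d p = cong (if_then 1ℤ else 0ℤ) (dec-true d p)

𝟙-false : {P : Set} (d : Dec P) → ¬ P → 𝟙 d ≡ 0ℤ
𝟙-false d ¬p = cong (if_then 1ℤ else 0ℤ) (dec-false d ¬p)

-- Finite sums of integers

∑ℤ : List A → (A → ℤ) → ℤ
∑ℤ []       f = 0ℤ
∑ℤ (x ∷ xs) f = f x ℤ.+ ∑ℤ xs f

∑ℤ-cong : ∀ {f g : A → ℤ} xs → (∀ x → f x ≡ g x) → ∑ℤ xs f ≡ ∑ℤ xs g
∑ℤ-cong []       f≡g = refl
∑ℤ-cong (x ∷ xs) f≡g = cong₂ ℤ._+_ (f≡g x) (∑ℤ-cong xs f≡g)

∑ℤ-zero : ∀ {f : A → ℤ} xs → (∀ {x} → x ∈ xs → f x ≡ 0ℤ) → ∑ℤ xs f ≡ 0ℤ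
∑ℤ-zero []       f≡0 = refl
∑ℤ-zero (x ∷ xs) f≡0 = cong₂ ℤ._+_ (f≡0 (here refl)) (∑ℤ-zero xs (f≡0 ∘ there))

-- Uniqueness of `xs` guarantees that `f y` is counted only once.
∑ℤ-single : ∀ {f : A → ℤ} {xs y} → Unique xs → y ∈ xs →
            (∀ {x} → x ∈ xs → x ≢ y → f x ≡ 0ℤ) → ∑ℤ xs f ≡ f y
∑ℤ-single {f = f} {x ∷ xs} (x≢ ∷ _) (here refl) f≡0 =
  trans (cong (ℤ._+_ (f x)) (∑ℤ-zero xs (λ x′∈ → f≡0 (there x′∈) (All.lookup x≢ x′∈ ∘ sym))))
        (ℤ.+-identityʳ (f x))
∑ℤ-single {f = f} {x ∷ xs} {y} (x≢ ∷ u) (there y∈) f≡0 =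
  trans (cong₂ ℤ._+_ (f≡0 (here refl) (All.lookup x≢ y∈)) (∑ℤ-single u y∈ (f≡0 ∘ there)))
        (ℤ.+-identityˡ (f y))

-- Coefficients

module _ (_≟ᴮ_ : DecidableEquality B) where

  coeff-basis : ∀ a b → coeff _≟ᴮ_ (basis a) b ≡ 𝟙 (a ≟ᴮ b)
  coeff-basis a b = ℤ.+-identityʳ _

  coeff-⊕ : ∀ p q b → coeff _≟ᴮ_ (p ⊕ q) b ≡ coeff _≟ᴮ_ p b ℤ.+ coeff _≟ᴮ_ q b
  coeff-⊕ []            q b = sym (ℤ.+-identityˡ _)
  coeff-⊕ ((c , a) ∷ p) q b = trans (cong (ℤ._+_ d) (coeff-⊕ p q b)) (sym (ℤ.+-assoc d (coeff _≟ᴮ_ p b) (coeff _≟ᴮ_ q b)))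
    where d = if does (a ≟ᴮ b) then c else 0ℤ

  coeff-· : ∀ c p b → coeff _≟ᴮ_ (c · p) b ≡ c ℤ.* coeff _≟ᴮ_ p b
  coeff-· c []            b = sym (ℤ.*-zeroʳ c)
  coeff-· c ((d , a) ∷ p) b =
    trans (cong₂ ℤ._+_ (scale (does (a ≟ᴮ b))) (coeff-· c p b)) (sym (ℤ.*-distribˡ-+ c _ _))
    where
    scale : ∀ β → (if β then c ℤ.* d else 0ℤ) ≡ c ℤ.* (if β then d else 0ℤ)
    scale true  = refl
    scale false = sym (ℤ.*-zeroʳ c)

  coeff-∑ : ∀ (xs : List A) f b → coeff _≟ᴮ_ (∑ xs f) b ≡ ∑ℤ xs (λ x → coeff _≟ᴮ_ (f x) b)
  coeff-∑ []       f b = refl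
  coeff-∑ (x ∷ xs) f b = trans (coeff-⊕ (f x) (∑ xs f) b) (cong (ℤ._+_ (coeff _≟ᴮ_ (f x) b)) (coeff-∑ xs f b))

infix 4 _≟ˣ_ _≟ʷ_ _≟ᶻ_

_≟ˣ_ : DecidableEquality X
x₀ ≟ˣ x₀ = yes refl
x₀ ≟ˣ x₁ = no λ ()
x₁ ≟ˣ x₀ = no λ ()
x₁ ≟ˣ x₁ = yes refl

_≟ʷ_ : DecidableEquality XWord
_≟ʷ_ = List.≡-dec _≟ˣ_

_≟ᶻ_ : DecidableEquality ZWord
_≟ᶻ_ = List.≡-dec _≟⁺_

𝟙-∷ : ∀ a c u v → 𝟙 (a ∷ u ≟ʷ c ∷ v) ≡ 𝟙 (a ≟ˣ c) ℤ.* 𝟙 (u ≟ʷ v)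
𝟙-∷ a c u v with does (a ≟ˣ c)
... | true  = sym (ℤ.*-identityˡ _)
... | false = refl

coeff-prepend-[] : ∀ a p → coeff _≟ʷ_ (prepend a p) [] ≡ 0ℤ
coeff-prepend-[] a []            = refl
coeff-prepend-[] a ((c , u) ∷ p) = trans (ℤ.+-identityˡ _) (coeff-prepend-[] a p)

-- On coefficients, prepending `a` becomes the removal of a first letter equal to `a`. This matches
-- one summand of the recursion for `⧢ʷ` with one summand of `Δ`.
coeff-prepend-∷ : ∀ a p c w → coeff _≟ʷ_ (prepend a p) (c ∷ w) ≡ 𝟙 (a ≟ˣ c) ℤ.* coeff _≟ʷ_ p w
coeff-prepend-∷ a []            c w = sym (ℤ.*-zeroʳ (𝟙 (a ≟ˣ c)))
coeff-prepend-∷ a ((d , u) ∷ p) c w =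
  trans (cong₂ ℤ._+_ scale (coeff-prepend-∷ a p c w)) (sym (ℤ.*-distribˡ-+ (𝟙 (a ≟ˣ c)) _ _))
  where
  scale : (if does (a ∷ u ≟ʷ c ∷ w) then d ℤ.* 1ℤ else 0ℤ) ≡ 𝟙 (a ≟ˣ c) ℤ.* (if does (u ≟ʷ w) then d else 0ℤ)
  scale with does (a ≟ˣ c) | does (u ≟ʷ w)
  ... | true  | true  = trans (ℤ.*-identityʳ d) (sym (ℤ.*-identityˡ d))
  ... | true  | false = refl
  ... | false | true  = refl
  ... | false | false = refl

-- Deshuffling

-- The sum of φ u v over all ways of splitting the letters of a word into
-- complementary subwords u and v, i.e. φ evaluated on the coproduct dual to ⧢.

Δ : (XWord → XWord → ℤ) → XWord → ℤ
Δ φ []      = φ [] []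
Δ φ (c ∷ w) = Δ (λ u v → φ (c ∷ u) v) w ℤ.+ Δ (λ u v → φ u (c ∷ v)) w

-- Agreement is demanded only on pairs that really arise by splitting `w`, so that weight and depth
-- of `w` are available when `φ` and `ψ` are compared.
Δ-cong-interleaving : ∀ {φ ψ} w → (∀ {u v} → Interleaving u v w → φ u v ≡ ψ u v) → Δ φ w ≡ Δ ψ w
Δ-cong-interleaving []      φ≡ψ = φ≡ψ []
Δ-cong-interleaving (c ∷ w) φ≡ψ =
  cong₂ ℤ._+_ (Δ-cong-interleaving w (λ i → φ≡ψ (consˡ i))) (Δ-cong-interleaving w (λ i → φ≡ψ (consʳ i)))

Δ-cong : ∀ {φ ψ} w → (∀ u v → φ u v ≡ ψ u v) → Δ φ w ≡ Δ ψ w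
Δ-cong w φ≡ψ = Δ-cong-interleaving w (λ {u} {v} _ → φ≡ψ u v)

Δ-zero : ∀ w → Δ (λ _ _ → 0ℤ) w ≡ 0ℤ
Δ-zero []      = refl
Δ-zero (c ∷ w) = cong₂ ℤ._+_ (Δ-zero w) (Δ-zero w)

Δ-+ : ∀ φ ψ w → Δ (λ u v → φ u v ℤ.+ ψ u v) w ≡ Δ φ w ℤ.+ Δ ψ w
Δ-+ φ ψ []      = refl
Δ-+ φ ψ (c ∷ w) = trans
  (cong₂ ℤ._+_ (Δ-+ (λ u v → φ (c ∷ u) v) (λ u v → ψ (c ∷ u) v) w) (Δ-+ (λ u v → φ u (c ∷ v)) (λ u v → ψ u (c ∷ v)) w))
  (interchange (Δ (λ u v → φ (c ∷ u) v) w) _ _ _)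
  where
  interchange : ∀ a b c d → (a ℤ.+ b) ℤ.+ (c ℤ.+ d) ≡ (a ℤ.+ c) ℤ.+ (b ℤ.+ d)
  interchange = solve-∀

Δ-* : ∀ a φ w → Δ (λ u v → a ℤ.* φ u v) w ≡ a ℤ.* Δ φ w
Δ-* a φ []      = refl
Δ-* a φ (c ∷ w) = trans (cong₂ ℤ._+_ (Δ-* a _ w) (Δ-* a _ w)) (sym (ℤ.*-distribˡ-+ a _ _))

Δ-∑ℤ : ∀ (xs : List A) (φ : A → XWord → XWord → ℤ) w →
       ∑ℤ xs (λ x → Δ (φ x) w) ≡ Δ (λ u v → ∑ℤ xs (λ x → φ x u v)) w
Δ-∑ℤ []       φ w = sym (Δ-zero w)
Δ-∑ℤ (x ∷ xs) φ w = trans (cong (ℤ._+_ (Δ (φ x) w)) (Δ-∑ℤ xs φ w)) (sym (Δ-+ (φ x) (λ u v → ∑ℤ xs (λ y → φ y u v)) w))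

-- Counit laws and duality with the shuffle product

ε : XWord → ℤ
ε u = 𝟙 ([] ≟ʷ u)

-- Counit law: only the splitting that sends every letter to the second factor survives.
Δ-εˡ : ∀ (f : XWord → ℤ) w → Δ (λ u v → ε u ℤ.* f v) w ≡ f w
Δ-εˡ f []      = ℤ.*-identityˡ _
Δ-εˡ f (c ∷ w) = trans (cong₂ ℤ._+_ (Δ-zero w) (Δ-εˡ (f ∘ (c ∷_)) w)) (ℤ.+-identityˡ _)

Δ-εʳ : ∀ (f : XWord → ℤ) w → Δ (λ u v → f u ℤ.* ε v) w ≡ f w
Δ-εʳ f []      = ℤ.*-identityʳ _
Δ-εʳ f (c ∷ w) = trans (cong₂ ℤ._+_ (Δ-εʳ (f ∘ (c ∷_)) w)
  (trans (Δ-cong w (λ u v → ℤ.*-zeroʳ (f u))) (Δ-zero w))) (ℤ.+-identityʳ _)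

δ : XWord → XWord → XWord → XWord → ℤ
δ u v u′ v′ = 𝟙 (u ≟ʷ u′) ℤ.* 𝟙 (v ≟ʷ v′)

-- The first letter `c` of the word is supplied either by `a ∷ u` or by `b ∷ v`, as in the two
-- summands of both recursions. If `u` or `v` is empty, this is a counit law.
coeff-⧢ʷ : ∀ u v w → coeff _≟ʷ_ (u ⧢ʷ v) w ≡ Δ (δ u v) w
coeff-⧢ʷ []      v       w       = trans (coeff-basis _≟ʷ_ v w) (sym (Δ-εˡ (λ v′ → 𝟙 (v ≟ʷ v′)) w))
coeff-⧢ʷ (a ∷ u) []      w       = trans (coeff-basis _≟ʷ_ (a ∷ u) w) (sym (Δ-εʳ (λ u′ → 𝟙 (a ∷ u ≟ʷ u′)) w))
coeff-⧢ʷ (a ∷ u) (b ∷ v) []      =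
  trans (coeff-⊕ _≟ʷ_ (prepend a (u ⧢ʷ (b ∷ v))) _ [])
        (cong₂ ℤ._+_ (coeff-prepend-[] a (u ⧢ʷ (b ∷ v))) (coeff-prepend-[] b ((a ∷ u) ⧢ʷ v)))
coeff-⧢ʷ (a ∷ u) (b ∷ v) (c ∷ w) =
  trans (coeff-⊕ _≟ʷ_ (prepend a (u ⧢ʷ (b ∷ v))) _ (c ∷ w)) (cong₂ ℤ._+_ left right)
  where
  left : coeff _≟ʷ_ (prepend a (u ⧢ʷ (b ∷ v))) (c ∷ w) ≡ Δ (λ u′ v′ → δ (a ∷ u) (b ∷ v) (c ∷ u′) v′) w
  left = begin
    coeff _≟ʷ_ (prepend a (u ⧢ʷ (b ∷ v))) (c ∷ w)
      ≡⟨ coeff-prepend-∷ a (u ⧢ʷ (b ∷ v)) c w ⟩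
    𝟙 (a ≟ˣ c) ℤ.* coeff _≟ʷ_ (u ⧢ʷ (b ∷ v)) w
      ≡⟨ cong (ℤ._*_ (𝟙 (a ≟ˣ c))) (coeff-⧢ʷ u (b ∷ v) w) ⟩
    𝟙 (a ≟ˣ c) ℤ.* Δ (δ u (b ∷ v)) w
      ≡⟨ Δ-* (𝟙 (a ≟ˣ c)) (δ u (b ∷ v)) w ⟨
    Δ (λ u′ v′ → 𝟙 (a ≟ˣ c) ℤ.* δ u (b ∷ v) u′ v′) w
      ≡⟨ Δ-cong w (λ u′ v′ → trans (sym (ℤ.*-assoc (𝟙 (a ≟ˣ c)) (𝟙 (u ≟ʷ u′)) _))
                                   (cong (ℤ._* 𝟙 (b ∷ v ≟ʷ v′)) (sym (𝟙-∷ a c u u′)))) ⟩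
    Δ (λ u′ v′ → δ (a ∷ u) (b ∷ v) (c ∷ u′) v′) w ∎

  swap : ∀ x y z → x ℤ.* (y ℤ.* z) ≡ y ℤ.* (x ℤ.* z)
  swap = solve-∀

  right : coeff _≟ʷ_ (prepend b ((a ∷ u) ⧢ʷ v)) (c ∷ w) ≡ Δ (λ u′ v′ → δ (a ∷ u) (b ∷ v) u′ (c ∷ v′)) w
  right = begin
    coeff _≟ʷ_ (prepend b ((a ∷ u) ⧢ʷ v)) (c ∷ w)
      ≡⟨ coeff-prepend-∷ b ((a ∷ u) ⧢ʷ v) c w ⟩
    𝟙 (b ≟ˣ c) ℤ.* coeff _≟ʷ_ ((a ∷ u) ⧢ʷ v) w
      ≡⟨ cong (ℤ._*_ (𝟙 (b ≟ˣ c))) (coeff-⧢ʷ (a ∷ u) v w) ⟩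
    𝟙 (b ≟ˣ c) ℤ.* Δ (δ (a ∷ u) v) w
      ≡⟨ Δ-* (𝟙 (b ≟ˣ c)) (δ (a ∷ u) v) w ⟨
    Δ (λ u′ v′ → 𝟙 (b ≟ˣ c) ℤ.* δ (a ∷ u) v u′ v′) w
      ≡⟨ Δ-cong w (λ u′ v′ → trans (swap (𝟙 (b ≟ˣ c)) (𝟙 (a ∷ u ≟ʷ u′)) (𝟙 (v ≟ʷ v′)))
                                   (cong (ℤ._*_ (𝟙 (a ∷ u ≟ʷ u′))) (sym (𝟙-∷ b c v v′)))) ⟩
    Δ (λ u′ v′ → δ (a ∷ u) (b ∷ v) u′ (c ∷ v′)) w ∎

-- The bijection ρ

-- `ρʷ` is a left inverse, but it takes a proof of admissibility. Its value has to be shown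
-- independent of that proof.
ρ⁻¹ʷ-injective : ∀ {s t} → ρ⁻¹ʷ s ≡ ρ⁻¹ʷ t → s ≡ t
ρ⁻¹ʷ-injective {s} {t} eq = trans (sym (ρʷ-ρ⁻¹ʷ s)) (trans (unique eq (ρ⁻¹ʷ-admissible s) (ρ⁻¹ʷ-admissible t)) (ρʷ-ρ⁻¹ʷ t))
  where
  uniqueᵉ : ∀ {u} i (h h′ : EndsInX₁ u) → ρᵉ i h ≡ ρᵉ i h′
  uniqueᵉ i [x₁]     [x₁]      = refl
  uniqueᵉ i (x₀ ∷ h) (x₀ ∷ h′) = uniqueᵉ (suc i) h h′
  uniqueᵉ i (x₁ ∷ h) (x₁ ∷ h′) = cong (_ ∷_) (uniqueᵉ 0 h h′)

  -- Variables `u` and `v` allow the equation to be matched with `refl`.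
  unique : ∀ {u v} → u ≡ v → (h : Admissible u) (h′ : Admissible v) → ρʷ h ≡ ρʷ h′
  unique refl empty    empty     = refl
  unique refl (ends h) (ends h′) = uniqueᵉ 0 h h′

-- `ρ` maps basis words bijectively to basis words, so coefficients are carried along the inverse.
coeff-ρ : ∀ {p} (h : InSpan Admissible p) w → coeff _≟ᶻ_ (ρ h) w ≡ coeff _≟ʷ_ p (ρ⁻¹ʷ w)
coeff-ρ {[]}          []       w = refl
coeff-ρ {(c , u) ∷ p} (h ∷ hs) w = cong₂ ℤ._+_ term (coeff-ρ hs w)
  where
  term : (if does (ρʷ h ≟ᶻ w) then c ℤ.* 1ℤ else 0ℤ) ≡ (if does (u ≟ʷ ρ⁻¹ʷ w) then c else 0ℤ)
  term with ρʷ h ≟ᶻ w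
  ... | yes refl rewrite dec-true (u ≟ʷ ρ⁻¹ʷ (ρʷ h)) (sym (ρ⁻¹ʷ-ρʷ h)) = ℤ.*-identityʳ c
  ... | no  ρh≢w rewrite dec-false (u ≟ʷ ρ⁻¹ʷ w) (λ eq → ρh≢w (ρ⁻¹ʷ-injective (trans (ρ⁻¹ʷ-ρʷ h) eq))) = refl

coeff-⧢̃ : ∀ s t w → coeff _≟ᶻ_ (basis s ⧢̃ basis t) w ≡ Δ (δ (ρ⁻¹ʷ s) (ρ⁻¹ʷ t)) (ρ⁻¹ʷ w)
coeff-⧢̃ s t w = begin
  coeff _≟ᶻ_ (basis s ⧢̃ basis t) w
    ≡⟨ coeff-ρ (⧢-admissible (ρ⁻¹-admissible (basis s)) (ρ⁻¹-admissible (basis t))) w ⟩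
  coeff _≟ʷ_ (1ℤ · (1ℤ · p ⊕ []) ⊕ []) W
    -- Each of the two linear extensions in `⧢` leaves a factor `1ℤ` and an empty remainder; these
    -- are stripped in turn.
    ≡⟨ cong (λ q → coeff _≟ʷ_ q W) (List.++-identityʳ (1ℤ · (1ℤ · p ⊕ []))) ⟩
  coeff _≟ʷ_ (1ℤ · (1ℤ · p ⊕ [])) W
    ≡⟨ trans (coeff-· _≟ʷ_ 1ℤ (1ℤ · p ⊕ []) W) (ℤ.*-identityˡ _) ⟩
  coeff _≟ʷ_ (1ℤ · p ⊕ []) W
    ≡⟨ cong (λ q → coeff _≟ʷ_ q W) (List.++-identityʳ (1ℤ · p)) ⟩
  coeff _≟ʷ_ (1ℤ · p) W
    ≡⟨ trans (coeff-· _≟ʷ_ 1ℤ p W) (ℤ.*-identityˡ _) ⟩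
  coeff _≟ʷ_ p W
    ≡⟨ coeff-⧢ʷ (ρ⁻¹ʷ s) (ρ⁻¹ʷ t) W ⟩
  Δ (δ (ρ⁻¹ʷ s) (ρ⁻¹ʷ t)) W ∎
  where
  p = ρ⁻¹ʷ s ⧢ʷ ρ⁻¹ʷ t
  W = ρ⁻¹ʷ w

-- The recursion for C

-- Every part is at least 1. Hence the exponents `T t j ∸ j` are true differences.
T-lower : ∀ (t : Vec ℕ⁺ m) {j} → j ≤ m → j ≤ T t j
T-lower t                 z≤n     = z≤n
T-lower (pos (suc i) ∷ t) (s≤s h) = s≤s (ℕ.≤-trans (T-lower t h) (ℕ.m≤n+m _ i))

2^T-∷ : ∀ s (t : Vec ℕ⁺ m) {j} → j ≤ m →
        2 ^ (T (s ∷ t) (suc j) ∸ suc j) ≡ 2 ^ (value s ∸ 1) * 2 ^ (T t j ∸ j)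
2^T-∷ (pos (suc i)) t {j} h =
  trans (cong (2 ^_) (ℕ.+-∸-assoc i (T-lower t h))) (ℕ.^-distribˡ-+-* 2 i (T t j ∸ j))

sum-applyUpTo-* : ∀ c (f g : ℕ → ℕ) m → (∀ {j} → j < m → f j ≡ c * g j) →
                  sum (applyUpTo f m) ≡ c * sum (applyUpTo g m)
sum-applyUpTo-* c f g zero    h = sym (ℕ.*-zeroʳ c)
sum-applyUpTo-* c f g (suc m) h =
  trans (cong₂ _+_ (h (s≤s z≤n)) (sum-applyUpTo-* c (f ∘ suc) (g ∘ suc) m (h ∘ s≤s)))
        (sym (ℕ.*-distribˡ-+ c (g 0) _))

-- This form also covers the empty tuple, where an empty sum plus `2 ^ 0` gives the conventional
-- value 1.
C-applyUpTo : ∀ (t : Vec ℕ⁺ m) → C t ≡ sum (applyUpTo (λ j → 2 ^ (T t (suc j) ∸ suc j)) m) + 2 ^ (T t m ∸ m)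
C-applyUpTo {zero}  []        = refl
C-applyUpTo {suc m} t@(_ ∷ _) = cong (λ l → sum l + 2 ^ (T t (suc m) ∸ suc m))
  (trans (sym (List.map-∘ (upTo (suc m)))) (List.map-upTo _ (suc m)))

-- A new first part raises every exponent of `C t` by `value s ∸ 1` and adds one term, for `j = 1`,
-- with exactly this exponent.
C-∷ : ∀ s (t : Vec ℕ⁺ m) → C (s ∷ t) ≡ 2 ^ (value s ∸ 1) * (1 + C t)
C-∷ {m} s t = begin
  C (s ∷ t)
    ≡⟨ C-applyUpTo (s ∷ t) ⟩
  2 ^ (T (s ∷ t) 1 ∸ 1) + sum (applyUpTo (λ j → 2 ^ (T (s ∷ t) (2 + j) ∸ (2 + j))) m) + 2 ^ (T (s ∷ t) (suc m) ∸ suc m)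
    ≡⟨ cong₂ _+_ (cong₂ _+_ (2^T-∷ s t z≤n) (sum-applyUpTo-* c _ _ m (λ {j} → 2^T-∷ s t {suc j}))) (2^T-∷ s t ℕ.≤-refl) ⟩
  c * 1 + c * S + c * e
    ≡⟨ factor c S e ⟩
  c * (1 + (S + e))
    ≡⟨ cong (λ x → c * (1 + x)) (C-applyUpTo t) ⟨
  c * (1 + C t) ∎
  where
  c = 2 ^ (value s ∸ 1)
  S = sum (applyUpTo (λ j → 2 ^ (T t (suc j) ∸ suc j)) m)
  e = 2 ^ (T t m ∸ m)
  factor : ∀ c S e → c * 1 + c * S + c * e ≡ c * (1 + (S + e))
  factor = ℕ.solve-∀

-- Counting splittings

-- Indicators of the words ρ⁻¹ʷ w with w = z_r, with w any nonempty word, and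
-- with w = z_{s₁,…} where s₁ = 1, respectively s₁ ≥ 2.

single nonempty first=1 first≥2 : XWord → ℤ

single []       = 0ℤ
single (x₀ ∷ u) = single u
single (x₁ ∷ u) = ε u

nonempty []       = 0ℤ
nonempty (x₀ ∷ u) = nonempty u
nonempty (x₁ ∷ u) = ε u ℤ.+ nonempty u

first=1 []       = 0ℤ
first=1 (x₀ ∷ u) = 0ℤ
first=1 (x₁ ∷ u) = ε u ℤ.+ nonempty u

first≥2 []       = 0ℤ
first≥2 (x₀ ∷ u) = nonempty u
first≥2 (x₁ ∷ u) = 0ℤ

infixr 7 _⊗_

_⊗_ : (XWord → ℤ) → (XWord → ℤ) → XWord → XWord → ℤ
(f ⊗ g) u v = f u ℤ.* g v

nonempty-split : ∀ u → nonempty u ≡ first≥2 u ℤ.+ first=1 u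
nonempty-split []       = refl
nonempty-split (x₀ ∷ u) = sym (ℤ.+-identityʳ _)
nonempty-split (x₁ ∷ u) = sym (ℤ.+-identityˡ _)

-- Values of the indicators on encoded words

single-x₀^ : ∀ i u → single (replicate i x₀ ++ u) ≡ single u
single-x₀^ zero    u = refl
single-x₀^ (suc i) u = single-x₀^ i u

nonempty-x₀^ : ∀ i u → nonempty (replicate i x₀ ++ u) ≡ nonempty u
nonempty-x₀^ zero    u = refl
nonempty-x₀^ (suc i) u = nonempty-x₀^ i u

ε-block : ∀ i u → ε (replicate i x₀ ++ x₁ ∷ u) ≡ 0ℤ
ε-block zero    u = refl
ε-block (suc i) u = refl

single-ρ⁻¹ʷ : ∀ r → single (ρ⁻¹ʷ (r ∷ [])) ≡ 1ℤ
single-ρ⁻¹ʷ r = single-x₀^ (value r ∸ 1) _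

single-ρ⁻¹ʷ-∷∷ : ∀ r s ss → single (ρ⁻¹ʷ (r ∷ s ∷ ss)) ≡ 0ℤ
single-ρ⁻¹ʷ-∷∷ r s ss = trans (single-x₀^ (value r ∸ 1) _) (ε-block (value s ∸ 1) _)

nonempty-ρ⁻¹ʷ : ∀ s ss → nonempty (ρ⁻¹ʷ (s ∷ ss)) ≡ 1ℤ

-- After an `x₁` an encoded word either stops or continues with another block; exactly one of the
-- two indicators is 1.
ε+nonempty-ρ⁻¹ʷ : ∀ ss → ε (ρ⁻¹ʷ ss) ℤ.+ nonempty (ρ⁻¹ʷ ss) ≡ 1ℤ
ε+nonempty-ρ⁻¹ʷ []       = refl
ε+nonempty-ρ⁻¹ʷ (s ∷ ss) = cong₂ ℤ._+_ (ε-block (value s ∸ 1) _) (nonempty-ρ⁻¹ʷ s ss)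

nonempty-ρ⁻¹ʷ s ss = trans (nonempty-x₀^ (value s ∸ 1) _) (ε+nonempty-ρ⁻¹ʷ ss)

first=1-ρ⁻¹ʷ : ∀ s ss → first=1 (ρ⁻¹ʷ (s ∷ ss)) ≡ 𝟙 (value s ≟ 1)
first=1-ρ⁻¹ʷ (pos 1)             ss = ε+nonempty-ρ⁻¹ʷ ss
first=1-ρ⁻¹ʷ (pos (suc (suc i))) ss = refl

first≥2-ρ⁻¹ʷ : ∀ s ss → 2 ≤ value s → first≥2 (ρ⁻¹ʷ (s ∷ ss)) ≡ 1ℤ
first≥2-ρ⁻¹ʷ (pos 1)             ss (s≤s ())
first≥2-ρ⁻¹ʷ (pos (suc (suc i))) ss _ = nonempty-ρ⁻¹ʷ (pos (suc i)) ss

ρ⁻¹ʷ-x₀∷ : ∀ s ss → ρ⁻¹ʷ (pos (suc (value s)) ∷ ss) ≡ x₀ ∷ ρ⁻¹ʷ (s ∷ ss)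
ρ⁻¹ʷ-x₀∷ (pos (suc i)) ss = refl

-- Converse to `single-ρ⁻¹ʷ`: off the encodings of words `z_r` the indicator vanishes. The views
-- below do the same for the other indicators, so that a sum of `δ`'s can later be recognised as a
-- product of indicators.
single-view : ∀ u → (∃ λ r → u ≡ ρ⁻¹ʷ (r ∷ [])) ⊎ single u ≡ 0ℤ
single-view []           = inj₂ refl
single-view (x₁ ∷ [])    = inj₁ (pos 1 , refl)
single-view (x₁ ∷ _ ∷ _) = inj₂ refl
single-view (x₀ ∷ u)     with single-view u
... | inj₁ (r , refl) = inj₁ (pos (suc (value r)) , sym (ρ⁻¹ʷ-x₀∷ r []))
... | inj₂ eq         = inj₂ eq

nonempty-view : ∀ u → (∃₂ λ s ss → u ≡ ρ⁻¹ʷ (s ∷ ss)) ⊎ nonempty u ≡ 0ℤ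
nonempty-view []           = inj₂ refl
nonempty-view (x₁ ∷ [])    = inj₁ (pos 1 , [] , refl)
nonempty-view (x₁ ∷ u@(_ ∷ _)) with nonempty-view u
... | inj₁ (s , ss , eq) = inj₁ (pos 1 , s ∷ ss , cong (x₁ ∷_) eq)
... | inj₂ eq            = inj₂ (trans (ℤ.+-identityˡ _) eq)
nonempty-view (x₀ ∷ u) with nonempty-view u
... | inj₁ (s , ss , refl) = inj₁ (pos (suc (value s)) , ss , sym (ρ⁻¹ʷ-x₀∷ s ss))
... | inj₂ eq              = inj₂ eq

first≥2-view : ∀ u → (∃₂ λ s ss → 2 ≤ value s × u ≡ ρ⁻¹ʷ (s ∷ ss)) ⊎ first≥2 u ≡ 0ℤ
first≥2-view []       = inj₂ refl
first≥2-view (x₁ ∷ u) = inj₂ refl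
first≥2-view (x₀ ∷ u) with nonempty-view u
... | inj₁ (s@(pos (suc _)) , ss , refl) = inj₁ (pos (suc (value s)) , ss , s≤s (s≤s z≤n) , refl)
... | inj₂ eq                            = inj₂ eq

-- Once the second factor has taken an `x₁` it may receive nothing more, and then all of `w` goes to
-- the first factor by the counit law.
Δ-single-ε+nonempty : ∀ w → Δ (λ u v → single u ℤ.* (ε v ℤ.+ nonempty v)) w ≡ single w ℤ.+ Δ (single ⊗ nonempty) w
Δ-single-ε+nonempty w = begin
  Δ (λ u v → single u ℤ.* (ε v ℤ.+ nonempty v)) w
    ≡⟨ Δ-cong w (λ u v → ℤ.*-distribˡ-+ (single u) (ε v) (nonempty v)) ⟩
  Δ (λ u v → (single ⊗ ε) u v ℤ.+ (single ⊗ nonempty) u v) w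
    ≡⟨ Δ-+ (single ⊗ ε) (single ⊗ nonempty) w ⟩
  Δ (single ⊗ ε) w ℤ.+ Δ (single ⊗ nonempty) w
    ≡⟨ cong (ℤ._+ Δ (single ⊗ nonempty) w) (Δ-εʳ single w) ⟩
  single w ℤ.+ Δ (single ⊗ nonempty) w ∎

-- An x₀ may go to either factor, and x₁ either closes the first factor or
-- goes to the second.

Δ-single-nonempty-block : ∀ i w →
  Δ (single ⊗ nonempty) (replicate i x₀ ++ x₁ ∷ w) ≡
  + (2 ^ i) ℤ.* (nonempty w ℤ.+ (single w ℤ.+ Δ (single ⊗ nonempty) w))
Δ-single-nonempty-block zero    w =
  trans (cong₂ ℤ._+_ (Δ-εˡ nonempty w) (Δ-single-ε+nonempty w)) (sym (ℤ.*-identityˡ _))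
Δ-single-nonempty-block (suc i) w =
  trans (cong (λ a → a ℤ.+ a) (Δ-single-nonempty-block i w))
        (trans (double (+ (2 ^ i)) _) (cong (ℤ._* _) (sym (ℤ.pos-* 2 (2 ^ i)))))
  where
  double : ∀ a b → a ℤ.* b ℤ.+ a ℤ.* b ≡ (+ 2) ℤ.* a ℤ.* b
  double = solve-∀

-- The summand `single` counts the splitting with empty second factor. With it included, the block
-- recursion is precisely `C-∷`.
Δ-single-nonempty : ∀ (t : Vec ℕ⁺ (suc m)) →
  single (ρ⁻¹ʷ (toList t)) ℤ.+ Δ (single ⊗ nonempty) (ρ⁻¹ʷ (toList t)) ≡ + C (init t)
-- A single `x₁` cannot serve both factors, so only the summand `single` remains, equal to
-- `C [] = 1`.
Δ-single-nonempty (s ∷ []) = cong₂ ℤ._+_ (single-ρ⁻¹ʷ s)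
  (trans (Δ-single-nonempty-block (value s ∸ 1) []) (ℤ.*-zeroʳ (+ (2 ^ (value s ∸ 1)))))
Δ-single-nonempty (s ∷ t@(s′ ∷ t′)) = begin
  single (ρ⁻¹ʷ (s ∷ toList t)) ℤ.+ Δ (single ⊗ nonempty) (ρ⁻¹ʷ (s ∷ toList t))
    ≡⟨ cong₂ ℤ._+_ (single-ρ⁻¹ʷ-∷∷ s s′ (toList t′)) (Δ-single-nonempty-block (value s ∸ 1) W) ⟩
  0ℤ ℤ.+ + (2 ^ (value s ∸ 1)) ℤ.* (nonempty W ℤ.+ (single W ℤ.+ Δ (single ⊗ nonempty) W))
    ≡⟨ ℤ.+-identityˡ _ ⟩
  + (2 ^ (value s ∸ 1)) ℤ.* (nonempty W ℤ.+ (single W ℤ.+ Δ (single ⊗ nonempty) W))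
    -- Since `t` is not empty, `nonempty W` supplies the 1 in `C-∷`.
    ≡⟨ cong (ℤ._*_ (+ (2 ^ (value s ∸ 1)))) (cong₂ ℤ._+_ (nonempty-ρ⁻¹ʷ s′ (toList t′)) (Δ-single-nonempty t)) ⟩
  + (2 ^ (value s ∸ 1)) ℤ.* + (1 + C (init t))
    ≡⟨ ℤ.pos-* (2 ^ (value s ∸ 1)) (1 + C (init t)) ⟨
  + (2 ^ (value s ∸ 1) * (1 + C (init t)))
    ≡⟨ cong +_ (C-∷ s (init t)) ⟨
  + C (init (s ∷ t)) ∎
  where W = ρ⁻¹ʷ (toList t)

-- The second factor starts with x₁, so it receives no x₀ of the first block.

Δ-single-first=1-block : ∀ i w →
  Δ (single ⊗ first=1) (replicate i x₀ ++ x₁ ∷ w) ≡ first=1 w ℤ.+ (single w ℤ.+ Δ (single ⊗ nonempty) w)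
Δ-single-first=1-block zero    w = cong₂ ℤ._+_ (Δ-εˡ first=1 w) (Δ-single-ε+nonempty w)
Δ-single-first=1-block (suc i) w = trans
  (cong₂ ℤ._+_ (Δ-single-first=1-block i w) (trans (Δ-cong W (λ u _ → ℤ.*-zeroʳ (single u))) (Δ-zero W)))
  (ℤ.+-identityʳ _)
  where W = replicate i x₀ ++ x₁ ∷ w

-- Complementary counting: `first≥2` is `nonempty` minus `first=1`. The former gives `C (init t)`,
-- because `single` vanishes on two or more blocks. The latter reduces to the tail `t′`, where
-- `init t′` is `tail (init t)`.
Δ-single-first≥2 : ∀ (t : Vec ℕ⁺ (2 + m)) →
  Δ (single ⊗ first≥2) (ρ⁻¹ʷ (toList t)) ≡ (+ C (init t) - + C (tail (init t))) - 𝟙 (value (head (tail t)) ≟ 1)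
Δ-single-first≥2 t@(s ∷ t′@(s′ ∷ t″)) = begin
  q
    ≡⟨ cancel q f ⟩
  (q ℤ.+ f) - f
    ≡⟨ cong₂ _-_ whole (Δ-single-first=1-block (value s ∸ 1) W′) ⟩
  + C (init t) - (first=1 W′ ℤ.+ (single W′ ℤ.+ Δ (single ⊗ nonempty) W′))
    ≡⟨ cong (_-_ (+ C (init t))) (cong₂ ℤ._+_ (first=1-ρ⁻¹ʷ s′ (toList t″)) (Δ-single-nonempty t′)) ⟩
  + C (init t) - (𝟙 (value s′ ≟ 1) ℤ.+ + C (init t′))
    ≡⟨ regroup (+ C (init t)) (𝟙 (value s′ ≟ 1)) (+ C (init t′)) ⟩
  (+ C (init t) - + C (init t′)) - 𝟙 (value s′ ≟ 1) ∎
  where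
  W  = ρ⁻¹ʷ (toList t)
  W′ = ρ⁻¹ʷ (toList t′)
  q  = Δ (single ⊗ first≥2) W
  f  = Δ (single ⊗ first=1) W

  cancel : ∀ a b → a ≡ a ℤ.+ b - b
  cancel = solve-∀

  regroup : ∀ a b c → a - (b ℤ.+ c) ≡ (a - c) - b
  regroup = solve-∀

  whole : q ℤ.+ f ≡ + C (init t)
  whole = begin
    q ℤ.+ f
      ≡⟨ Δ-+ (single ⊗ first≥2) (single ⊗ first=1) W ⟨
    Δ (λ u v → (single ⊗ first≥2) u v ℤ.+ (single ⊗ first=1) u v) W
      ≡⟨ Δ-cong W (λ u v → trans (cong (ℤ._*_ (single u)) (nonempty-split v)) (ℤ.*-distribˡ-+ (single u) (first≥2 v) (first=1 v))) ⟨
    Δ (single ⊗ nonempty) W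
      ≡⟨ ℤ.+-identityˡ _ ⟨
    0ℤ ℤ.+ Δ (single ⊗ nonempty) W
      ≡⟨ cong (ℤ._+ Δ (single ⊗ nonempty) W) (single-ρ⁻¹ʷ-∷∷ s s′ (toList t″)) ⟨
    single W ℤ.+ Δ (single ⊗ nonempty) W
      ≡⟨ Δ-single-nonempty t ⟩
    + C (init t) ∎

-- Summing over compositions

zweight : ZWord → ℕ
zweight w = sum (List.map value w)

zweight-toList : ∀ (t : Vec ℕ⁺ m) → zweight (toList t) ≡ weight t
zweight-toList []      = refl
zweight-toList (s ∷ t) = cong (value s ℕ.+_) (zweight-toList t)

-- Additivity of weight and depth under splitting

letters : (X → ℕ) → XWord → ℕ
letters μ u = sum (List.map μ u)

letters-interleaving : ∀ μ {u v w} → Interleaving u v w → letters μ w ≡ letters μ u + letters μ v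
letters-interleaving μ []                    = refl
letters-interleaving μ {a ∷ u} {v} (consˡ i) =
  trans (cong (μ a ℕ.+_) (letters-interleaving μ i)) (sym (ℕ.+-assoc (μ a) (letters μ u) (letters μ v)))
letters-interleaving μ {u} {a ∷ v} (consʳ i) =
  trans (cong (μ a ℕ.+_) (letters-interleaving μ i)) (swap (μ a) (letters μ u) (letters μ v))
  where
  swap : ∀ a b c → a + (b + c) ≡ b + (a + c)
  swap = ℕ.solve-∀

letters-x₀^ : ∀ μ i u → letters μ (replicate i x₀ ++ u) ≡ i * μ x₀ + letters μ u
letters-x₀^ μ zero    u = refl
letters-x₀^ μ (suc i) u = trans (cong (μ x₀ ℕ.+_) (letters-x₀^ μ i u)) (sym (ℕ.+-assoc (μ x₀) (i * μ x₀) _))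

deg : X → ℕ
deg _ = 1

depth : X → ℕ
depth x₀ = 0
depth x₁ = 1

-- The block of `s` has `value s ∸ 1` letters `x₀` and one `x₁`, so weight becomes word length and,
-- in `letters-depth`, depth becomes the number of `x₁`.
letters-deg : ∀ w → letters deg (ρ⁻¹ʷ w) ≡ zweight w
letters-deg []                 = refl
letters-deg (pos (suc i) ∷ ss) = begin
  letters deg (replicate i x₀ ++ x₁ ∷ ρ⁻¹ʷ ss)  ≡⟨ letters-x₀^ deg i (x₁ ∷ ρ⁻¹ʷ ss) ⟩
  i * 1 + suc (letters deg (ρ⁻¹ʷ ss))           ≡⟨ cong₂ _+_ (ℕ.*-identityʳ i) (cong suc (letters-deg ss)) ⟩
  i + suc (zweight ss)                          ≡⟨ ℕ.+-suc i (zweight ss) ⟩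
  suc i + zweight ss                            ∎

letters-depth : ∀ w → letters depth (ρ⁻¹ʷ w) ≡ length w
letters-depth []       = refl
letters-depth (s ∷ ss) =
  trans (letters-x₀^ depth (value s ∸ 1) (x₁ ∷ ρ⁻¹ʷ ss))
        (cong₂ _+_ (ℕ.*-zeroʳ (value s ∸ 1)) (cong suc (letters-depth ss)))

module _ {s t w} (i : Interleaving (ρ⁻¹ʷ s) (ρ⁻¹ʷ t) (ρ⁻¹ʷ w)) where

  zweight-interleaving : zweight w ≡ zweight s + zweight t
  zweight-interleaving = begin
    zweight w                                    ≡⟨ letters-deg w ⟨
    letters deg (ρ⁻¹ʷ w)                         ≡⟨ letters-interleaving deg i ⟩
    letters deg (ρ⁻¹ʷ s) + letters deg (ρ⁻¹ʷ t)  ≡⟨ cong₂ _+_ (letters-deg s) (letters-deg t) ⟩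
    zweight s + zweight t                        ∎

  length-interleaving : length w ≡ length s + length t
  length-interleaving = begin
    length w                                         ≡⟨ letters-depth w ⟨
    letters depth (ρ⁻¹ʷ w)                           ≡⟨ letters-interleaving depth i ⟩
    letters depth (ρ⁻¹ʷ s) + letters depth (ρ⁻¹ʷ t)  ≡⟨ cong₂ _+_ (letters-depth s) (letters-depth t) ⟩
    length s + length t                              ∎

toList-length : ∀ (t : Vec ℕ⁺ m) → length (toList t) ≡ m
toList-length []      = refl
toList-length (_ ∷ t) = cong suc (toList-length t)

toList-surjective : ∀ w → length w ≡ m → ∃ λ (t : Vec ℕ⁺ m) → toList t ≡ w
toList-surjective w refl = fromList w , Vec.toList∘fromList w

toList-injective : ∀ (s t : Vec ℕ⁺ m) → toList s ≡ toList t → s ≡ t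
toList-injective s t eq = trans (sym (Vec.cast-is-id refl s)) (Vec.toList-injective refl s t eq)

δ-refl : ∀ u v → δ u v u v ≡ 1ℤ
δ-refl u v = cong₂ ℤ._*_ (𝟙-true (u ≟ʷ u) refl) (𝟙-true (v ≟ʷ v) refl)

-- The hypothesis lets the second inequality be proved after the first words have been identified.
δ-zero : ∀ u v {u′ v′} → (u ≡ u′ → v ≢ v′) → δ u v u′ v′ ≡ 0ℤ
δ-zero u v {u′} {v′} ne with u ≟ʷ u′
... | yes eq = trans (ℤ.*-identityˡ _) (𝟙-false (v ≟ʷ v′) (ne eq))
... | no  _  = refl

1≢0 : 1ℤ ≢ 0ℤ
1≢0 ()

-- Comparison of the coefficients of both sides

module _ (m n : ℕ) where

  k = 2 + m

  coeffs : Vec ℕ⁺ k → ℤ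
  coeffs t = + C (init t) - + C (tail (init t))

  -- An entry is `r` followed by `s₁,…,s_{k-1}`, again a composition of `n` into `k` parts; the
  -- filter is `s₁ ≥ 2`.
  factors : List (Vec ℕ⁺ k)
  factors = filter (λ rs → 2 ≤? value (head (tail rs))) (compositions k n)

  δ-factors : Vec ℕ⁺ k → XWord → XWord → ℤ
  δ-factors rs = δ (ρ⁻¹ʷ (head rs ∷ [])) (ρ⁻¹ʷ (toList (tail rs)))

  ∈-factors⁻ : ∀ {rs} → rs ∈ factors → weight rs ≡ n × 2 ≤ value (head (tail rs))
  ∈-factors⁻ rs∈ with ∈-filter⁻ (λ rs → 2 ≤? value (head (tail rs))) {xs = compositions k n} rs∈
  ... | rs∈′ , h = ∈-compositions⁻ n rs∈′ , h

  -- At most one entry encodes the pair `u`, `v`, by injectivity of `ρ⁻¹ʷ`. If both indicators are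
  -- 1, additivity of weight and depth shows that this entry occurs in `factors`.
  ∑-δ-factors : ∀ {w u v} → length w ≡ k → zweight w ≡ n → Interleaving u v (ρ⁻¹ʷ w) →
                ∑ℤ factors (λ rs → δ-factors rs u v) ≡ (single ⊗ first≥2) u v
  ∑-δ-factors {w} {u} {v} lw ww i with single-view u | first≥2-view v
  ... | inj₂ eq | _ = trans
    (∑ℤ-zero factors (λ { {r ∷ s} _ → δ-zero (ρ⁻¹ʷ (r ∷ [])) (ρ⁻¹ʷ (toList s)) (λ { refl _ → 1≢0 (trans (sym (single-ρ⁻¹ʷ r)) eq) }) }))
    (sym (cong (ℤ._* first≥2 v) eq))
  ... | inj₁ _ | inj₂ eq = trans
    (∑ℤ-zero factors (λ { {r ∷ s ∷ ss} rs∈ → δ-zero (ρ⁻¹ʷ (r ∷ [])) (ρ⁻¹ʷ (s ∷ toList ss))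
      (λ { _ refl → 1≢0 (trans (sym (first≥2-ρ⁻¹ʷ s (toList ss) (proj₂ (∈-factors⁻ rs∈)))) eq) }) }))
    (sym (trans (cong (ℤ._*_ (single u)) eq) (ℤ.*-zeroʳ (single u))))
  ... | inj₁ (r , refl) | inj₁ (s , ss , 2≤s , refl)
    -- The two successors removed account for `r` and `s₁`, leaving `m` entries in `ss`.
    with toList-surjective ss (ℕ.suc-injective (ℕ.suc-injective (trans (sym (length-interleaving {r ∷ []} {s ∷ ss} {w} i)) lw)))
  ... | t , refl = begin
    ∑ℤ factors (λ rs → δ-factors rs u v)
      ≡⟨ ∑ℤ-single (Unique.filter⁺ _ (compositions-unique k n)) t₀∈ others ⟩
    δ-factors t₀ u v
      ≡⟨ δ-refl u v ⟩
    1ℤ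
      ≡⟨ cong₂ ℤ._*_ (single-ρ⁻¹ʷ r) (first≥2-ρ⁻¹ʷ s (toList t) 2≤s) ⟨
    (single ⊗ first≥2) u v ∎
    where
    t₀ : Vec ℕ⁺ k
    t₀ = r ∷ s ∷ t

    t₀-weight : weight t₀ ≡ n
    t₀-weight = begin
      value r + weight (s ∷ t)                ≡⟨ cong₂ _+_ (ℕ.+-identityʳ (value r)) (zweight-toList (s ∷ t)) ⟨
      value r + 0 + zweight (s ∷ toList t)    ≡⟨ zweight-interleaving {r ∷ []} {s ∷ toList t} {w} i ⟨
      zweight w                               ≡⟨ ww ⟩
      n                                       ∎

    t₀∈ : t₀ ∈ factors
    t₀∈ = ∈-filter⁺ _ (∈-compositions⁺ n t₀ t₀-weight) 2≤s

    others : ∀ {rs} → rs ∈ factors → rs ≢ t₀ → δ-factors rs u v ≡ 0ℤ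
    others {r′ ∷ t′} _ ne = δ-zero (ρ⁻¹ʷ (r′ ∷ [])) (ρ⁻¹ʷ (toList t′)) λ eq eq′ →
      ne (cong₂ _∷_ (List.∷-injectiveˡ (ρ⁻¹ʷ-injective {r′ ∷ []} {r ∷ []} eq))
                    (toList-injective t′ (s ∷ t) (ρ⁻¹ʷ-injective {toList t′} {s ∷ toList t} eq′)))

  lhs : 𝓗
  lhs = ∑ factors (λ rs → z [ head rs ] ⧢̃ z (tail rs))

  coeff-lhs : ∀ w → coeff _≟ᶻ_ lhs w ≡ ∑ℤ factors (λ rs → Δ (δ-factors rs) (ρ⁻¹ʷ w))
  coeff-lhs w = trans (coeff-∑ _≟ᶻ_ factors (λ rs → z [ head rs ] ⧢̃ z (tail rs)) w)
                      (∑ℤ-cong factors (λ rs → coeff-⧢̃ (head rs ∷ []) (toList (tail rs)) w))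

  coeff-lhs-composition : ∀ (t : Vec ℕ⁺ k) → weight t ≡ n →
    coeff _≟ᶻ_ lhs (toList t) ≡ coeffs t - 𝟙 (value (head (tail t)) ≟ 1)
  coeff-lhs-composition t wt = begin
    coeff _≟ᶻ_ lhs (toList t)
      ≡⟨ coeff-lhs (toList t) ⟩
    ∑ℤ factors (λ rs → Δ (δ-factors rs) W)
      ≡⟨ Δ-∑ℤ factors δ-factors W ⟩
    Δ (λ u v → ∑ℤ factors (λ rs → δ-factors rs u v)) W
      ≡⟨ Δ-cong-interleaving W (∑-δ-factors {toList t} (toList-length t) (trans (zweight-toList t) wt)) ⟩
    Δ (single ⊗ first≥2) W
      ≡⟨ Δ-single-first≥2 t ⟩
    coeffs t - 𝟙 (value (head (tail t)) ≟ 1) ∎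
    where W = ρ⁻¹ʷ (toList t)

  -- A word occurring in a product has depth `1 + (k - 1)` and weight `n`, hence would be a
  -- composition.
  coeff-lhs-other : ∀ w → (∀ (t : Vec ℕ⁺ k) → weight t ≡ n → toList t ≢ w) → coeff _≟ᶻ_ lhs w ≡ 0ℤ
  coeff-lhs-other w not-comp = trans (coeff-lhs w) (∑ℤ-zero factors vanish)
    where
    vanish : ∀ {rs} → rs ∈ factors → Δ (δ-factors rs) (ρ⁻¹ʷ w) ≡ 0ℤ
    vanish {rs@(r ∷ s)} rs∈ = trans (Δ-cong-interleaving (ρ⁻¹ʷ w) no-interleaving) (Δ-zero (ρ⁻¹ʷ w))
      where
      not-interleaving : ¬ Interleaving (ρ⁻¹ʷ (r ∷ [])) (ρ⁻¹ʷ (toList s)) (ρ⁻¹ʷ w)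
      not-interleaving i with toList-surjective w
        (trans (length-interleaving {r ∷ []} {toList s} {w} i) (cong suc (toList-length s)))
      ... | t , refl = not-comp t (begin
        weight t                            ≡⟨ zweight-toList t ⟨
        zweight (toList t)                  ≡⟨ zweight-interleaving {r ∷ []} {toList s} {toList t} i ⟩
        value r + 0 + zweight (toList s)    ≡⟨ cong₂ _+_ (ℕ.+-identityʳ (value r)) (zweight-toList s) ⟩
        weight rs                           ≡⟨ proj₁ (∈-factors⁻ rs∈) ⟩
        n                                   ∎) refl

      no-interleaving : ∀ {u v} → Interleaving u v (ρ⁻¹ʷ w) → δ-factors rs u v ≡ 0ℤ
      no-interleaving i = δ-zero (ρ⁻¹ʷ (r ∷ [])) (ρ⁻¹ʷ (toList s)) (λ { refl refl → not-interleaving i })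

  second=1 : List (Vec ℕ⁺ k)
  second=1 = filter (λ t → value (head (tail t)) ≟ 1) (compositions k n)

  rhs : 𝓗
  rhs = ∑ (compositions k n) (λ t → coeffs t · z t) ⊖ ∑ second=1 (λ t → z t)

  coeff-rhs : ∀ w → coeff _≟ᶻ_ rhs w ≡
    ∑ℤ (compositions k n) (λ t → coeffs t ℤ.* 𝟙 (toList t ≟ᶻ w)) - ∑ℤ second=1 (λ t → 𝟙 (toList t ≟ᶻ w))
  coeff-rhs w = begin
    coeff _≟ᶻ_ rhs w
      ≡⟨ coeff-⊕ _≟ᶻ_ p ((ℤ.- 1ℤ) · q) w ⟩
    coeff _≟ᶻ_ p w ℤ.+ coeff _≟ᶻ_ ((ℤ.- 1ℤ) · q) w
      ≡⟨ cong (ℤ._+_ (coeff _≟ᶻ_ p w)) (trans (coeff-· _≟ᶻ_ (ℤ.- 1ℤ) q w) (ℤ.-1*i≡-i (coeff _≟ᶻ_ q w))) ⟩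
    coeff _≟ᶻ_ p w - coeff _≟ᶻ_ q w
      ≡⟨ cong₂ _-_ (trans (coeff-∑ _≟ᶻ_ (compositions k n) (λ t → coeffs t · z t) w) (∑ℤ-cong (compositions k n) coeff-term))
                   (trans (coeff-∑ _≟ᶻ_ second=1 z w) (∑ℤ-cong second=1 (λ t → coeff-basis _≟ᶻ_ (toList t) w))) ⟩
    ∑ℤ (compositions k n) (λ t → coeffs t ℤ.* 𝟙 (toList t ≟ᶻ w)) - ∑ℤ second=1 (λ t → 𝟙 (toList t ≟ᶻ w)) ∎
    where
    p = ∑ (compositions k n) (λ t → coeffs t · z t)
    q = ∑ second=1 z
    coeff-term : ∀ t → coeff _≟ᶻ_ (coeffs t · z t) w ≡ coeffs t ℤ.* 𝟙 (toList t ≟ᶻ w)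
    coeff-term t = trans (coeff-· _≟ᶻ_ (coeffs t) (z t) w) (cong (ℤ._*_ (coeffs t)) (coeff-basis _≟ᶻ_ (toList t) w))

  coeff-rhs-composition : ∀ t → weight t ≡ n → coeff _≟ᶻ_ rhs (toList t) ≡ coeffs t - 𝟙 (value (head (tail t)) ≟ 1)
  coeff-rhs-composition t wt = trans (coeff-rhs (toList t)) (cong₂ _-_ first (second (value (head (tail t)) ≟ 1)))
    where
    t∈ : t ∈ compositions k n
    t∈ = ∈-compositions⁺ n t wt

    𝟙-other : ∀ {t′} → t′ ≢ t → 𝟙 (toList t′ ≟ᶻ toList t) ≡ 0ℤ
    𝟙-other {t′} ne = 𝟙-false (toList t′ ≟ᶻ toList t) (ne ∘ toList-injective t′ t)

    𝟙-self : 𝟙 (toList t ≟ᶻ toList t) ≡ 1ℤ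
    𝟙-self = 𝟙-true (toList t ≟ᶻ toList t) refl

    first : ∑ℤ (compositions k n) (λ t′ → coeffs t′ ℤ.* 𝟙 (toList t′ ≟ᶻ toList t)) ≡ coeffs t
    first = trans
      (∑ℤ-single (compositions-unique k n) t∈
        (λ {t′} _ ne → trans (cong (ℤ._*_ (coeffs t′)) (𝟙-other ne)) (ℤ.*-zeroʳ (coeffs t′))))
      (trans (cong (ℤ._*_ (coeffs t)) 𝟙-self) (ℤ.*-identityʳ (coeffs t)))

    -- With the decision `d` as an argument, both outcomes of `t₂ = 1` can be matched directly: `t`
    -- lies in `second=1` or no entry equals it.
    second : ∀ d → ∑ℤ second=1 (λ t′ → 𝟙 (toList t′ ≟ᶻ toList t)) ≡ 𝟙 d
    second (yes h) = trans
      (∑ℤ-single (Unique.filter⁺ _ (compositions-unique k n)) (∈-filter⁺ _ t∈ h) (λ _ → 𝟙-other)) 𝟙-self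
    second (no ¬h) = ∑ℤ-zero second=1 (λ {t′} t′∈ → 𝟙-other {t′}
      (λ { refl → ¬h (proj₂ (∈-filter⁻ (λ t′ → value (head (tail t′)) ≟ 1) {xs = compositions k n} t′∈)) }))

  coeff-rhs-other : ∀ w → (∀ (t : Vec ℕ⁺ k) → weight t ≡ n → toList t ≢ w) → coeff _≟ᶻ_ rhs w ≡ 0ℤ
  coeff-rhs-other w not-comp = trans (coeff-rhs w) (cong₂ _-_
    (∑ℤ-zero (compositions k n) (λ {t} t∈ → trans (cong (ℤ._*_ (coeffs t)) (𝟙-other t∈)) (ℤ.*-zeroʳ (coeffs t))))
    (∑ℤ-zero second=1 (λ t∈ → 𝟙-other (proj₁ (∈-filter⁻ (λ t → value (head (tail t)) ≟ 1) t∈)))))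
    where
    𝟙-other : ∀ {t} → t ∈ compositions k n → 𝟙 (toList t ≟ᶻ w) ≡ 0ℤ
    𝟙-other {t} t∈ = 𝟙-false (toList t ≟ᶻ w) (not-comp t (∈-compositions⁻ n t∈))

  -- Length and weight alone decide whether a word comes from a composition, since the letters are
  -- already positive.
  composition? : ∀ w → (∃ λ (t : Vec ℕ⁺ k) → weight t ≡ n × toList t ≡ w) ⊎
                       (∀ (t : Vec ℕ⁺ k) → weight t ≡ n → toList t ≢ w)
  composition? w with length w ≟ k | zweight w ≟ n
  ... | no  ne | _      = inj₂ (λ { t _ refl → ne (toList-length t) })
  ... | yes _  | no  ne = inj₂ (λ { t wt refl → ne (trans (zweight-toList t) wt) })
  ... | yes lw | yes ww with toList-surjective w lw
  ...   | t , refl = inj₁ (t , trans (sym (zweight-toList t)) ww , refl)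

  lhs≈rhs : lhs ≈ rhs
  lhs≈rhs w with composition? w
  ... | inj₁ (t , wt , refl) = trans (coeff-lhs-composition t wt) (sym (coeff-rhs-composition t wt))
  ... | inj₂ not-comp        = trans (coeff-lhs-other w not-comp) (sym (coeff-rhs-other w not-comp))

theorem2p6 : (m n : ℕ) → let k = 2 + m in k + 1 ≤ n →
    ∑ (filter (λ rs → 2 ≤? value (head (tail rs))) (compositions k n)) (λ rs → z [ head rs ] ⧢̃ z (tail rs))
    ≈ ∑ (compositions k n) (λ t → (+ C (init t) - + C (tail (init t))) · z t)
    ⊖ ∑ (filter (λ t → value (head (tail t)) ≟ 1) (compositions k n)) (λ t → z t)
theorem2p6 m n _ = lhs≈rhs m n
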